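{- Let $S\in\mathcal S(n)$, let $k\le n$, let $L\ge n$ with $\tau=L/\sqrt{nk}$ and suppose $M=2L/\tau+k$ is an integer. Let $P_0$ be a $\tau$-post and suppose the $k\times M$ $\tau$-fence-tree with root $P_0$ exists in $S$, with nodes $P_i^m=(X_i^m,Y_i^m)$, and put $\Delta x=X_k^M-X_1^1$. Then (a) the path in the tree from the root $P_1^1$ to $P_k^M$ (the concatenation of the tree edges along it) has length at most $4L+3\tau\Delta x$; and (b) the total length of all edges of the tree is at most $k(3L+3\tau\Delta x)$.
   Context: Setting: $\mathcal S(n)$ is the class of scenes in the plane consisting of finitely many non-overlapping axis-parallel rectangular obstacles of width and height at least $1$, with integral corner $x$-coordinates, start $s=(0,0)$ and target the vertical line ("wall") $x=n$. Up/down/right mean the $+y$/$-y$/$+x$ directions. A $\tau$-post is a vertical segment of height $2\tau$ contained in the left edge of an obstacle; it is identified with its center point. A $\tau$-path from a point $(x,y_0)$ is the path obtained by moving right along the line $y=y_0$: when an obstacle is hit whose nearest corner is at distance less than $\tau$, the path goes around that corner to the point on the opposite (right) side of the obstacle with $y$-coordinate $y_0$ and continues right; when an obstacle is hit whose nearest corner is at distance at least $\tau$, the path stops, and the $\tau$-post centered at the hit point is the end of the path; if the wall is reached the path stops there. For a $\tau$-post $P$, its up-child (resp. down-child) is the $\tau$-post at the end of the $\tau$-path starting from the top (resp. bottom) endpoint of $P$ (undefined if that $\tau$-path reaches the wall); the up-edge (resp. down-edge) from $P$ to that child is the vertical segment of length $\tau$ from the center of $P$ to its top (resp. bottom) endpoint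 followed by that $\tau$-path. The $k\times M$ $\tau$-fence-tree with root $P_0$ is the binary tree with nodes $P_i^m$, $1\le i\le k$, $1\le m\le M$, defined by: $P_1^1=P_0$; $P_1^m$ is the up-child of $P_1^{m-1}$ for $m\ge2$; $P_i^1$ is the down-child of $P_{i-1}^1$ for $i\ge2$; and for $i,m\ge2$, $P_i^m$ is the down-child of $P_{i-1}^m$ if $X_{i-1}^m> X_i^{m-1}$, and the up-child of $P_i^{m-1}$ otherwise. Its edges are the corresponding up- and down-edges from each node to its children. The tree is said to exist in $S$ if all these children are defined (no $\tau$-path used reaches the wall). -}

module Defs where

open import Algebra.Bundles using (CommutativeRing)
import Algebra.Construct.NaturalChoice.Max as Max
import Algebra.Definitions.RawMonoid as RawMonoidDefinitions
open import Data.Fin.Base using (Fin; toℕ)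
open import Data.Fin.Properties using (toℕ<n)
open import Data.Integer.Base using (ℤ; +_; -[1+_])
open import Data.List.Base using (List; []; _∷_; _++_; map; foldr)
open import Data.List.Membership.Propositional using (_∈_)
open import Data.List.Relation.Unary.AllPairs using (AllPairs)
open import Data.Nat.Base as ℕ using (ℕ; suc; z≤n; s≤s)
import Data.Nat.Properties as ℕ
open import Data.Product.Base using (∃; _×_; _,_)
open import Level using (0ℓ)
open import Relation.Binary.Bundles using (TotalOrder)
open import Relation.Binary.Core using (Rel)
import Relation.Binary.Construct.NonStrictToStrict as NonStrictToStrict
open import Relation.Binary.PropositionalEquality.Core using (_≡_)
open import Relation.Binary.Structures using (IsDecTotalOrder)
open import Relation.Nullary.Negation.Core using (¬_)

-- The real numbers, axiomatised up to isomorphism as a Dedekind-complete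
-- ordered field.  The order is decidable, as it is classically.
record Reals : Set₁ where
  infix  4 _≤_
  infixl 7 _/_
  infix  8 _⁻¹

  field
    commutativeRing : CommutativeRing 0ℓ 0ℓ

  open CommutativeRing commutativeRing public

  field
    _≤_             : Rel Carrier 0ℓ
    isDecTotalOrder : IsDecTotalOrder _≈_ _≤_
    _⁻¹             : Carrier → Carrier

  private
    IsUpperBound : (Carrier → Set) → Carrier → Set
    IsUpperBound P b = ∀ {x} → P x → x ≤ b

  field
    0≉1         : ¬ 0# ≈ 1#
    -- The value of 0# ⁻¹ is left unspecified.
    *-inverseʳ  : ∀ {x} → ¬ x ≈ 0# → x * x ⁻¹ ≈ 1#
    +-monoˡ-≤   : ∀ {x y} z → x ≤ y → x + z ≤ y + z
    *-nonNeg    : ∀ {x y} → 0# ≤ x → 0# ≤ y → 0# ≤ x * y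
    complete    : (P : Carrier → Set) → ∃ P → ∃ (IsUpperBound P) →
                  ∃ λ s → IsUpperBound P s × (∀ {b} → IsUpperBound P b → s ≤ b)

  totalOrder : TotalOrder 0ℓ 0ℓ 0ℓ
  totalOrder = record { isTotalOrder = IsDecTotalOrder.isTotalOrder isDecTotalOrder }

  open NonStrictToStrict _≈_ _≤_ public using (_<_)
  open Max totalOrder public using (_⊔_)
  open RawMonoidDefinitions +-rawMonoid public using (sum) renaming (_×_ to _·_)

  _/_ : Carrier → Carrier → Carrier
  x / y = x * y ⁻¹

  ∣_∣ : Carrier → Carrier
  ∣ x ∣ = x ⊔ (- x)

  fromℕ : ℕ → Carrier
  fromℕ n = n · 1#

  fromℤ : ℤ → Carrier
  fromℤ (+ n)    = fromℕ n
  fromℤ -[1+ n ] = - fromℕ (suc n)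

  IsIntegral : Carrier → Set
  IsIntegral x = ∃ λ z → x ≈ fromℤ z

  _IsSquareRootOf_ : Carrier → Carrier → Set
  r IsSquareRootOf a = 0# ≤ r × r * r ≈ a

module Navigation (ℝ : Reals) where
  open Reals ℝ

  record Point : Set where
    constructor ⟨_,_⟩
    field
      X Y : Carrier

  open Point public

  data Segment : Set where
    horizontal : (x x′ y : Carrier) → Segment
    vertical   : (x y y′ : Carrier) → Segment

  segmentLength : Segment → Carrier
  segmentLength (horizontal x x′ y) = ∣ x′ - x ∣
  segmentLength (vertical x y y′)   = ∣ y′ - y ∣

  Path : Set
  Path = List Segment

  pathLength : Path → Carrier
  pathLength π = foldr _+_ 0# (map segmentLength π)

  data Direction : Set where
    up down : Direction

  record Obstacle : Set where
    field
      left right bottom top : Carrier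
      left-integral  : IsIntegral left
      right-integral : IsIntegral right
      width≥1        : 1# ≤ right - left
      height≥1       : 1# ≤ top - bottom

  open Obstacle public

  record Interior (o : Obstacle) (p : Point) : Set where
    field
      left<X   : left o < X p
      X<right  : X p < right o
      bottom<Y : bottom o < Y p
      Y<top    : Y p < top o

  NonOverlapping : Obstacle → Obstacle → Set
  NonOverlapping o o′ = ∀ p → ¬ (Interior o p × Interior o′ p)

  start : Point
  start = ⟨ 0# , 0# ⟩

  -- The index n is the position of the wall, the line X p ≈ fromℕ n.
  record Scene (n : ℕ) : Set where
    field
      obstacles      : List Obstacle
      nonOverlapping : AllPairs NonOverlapping obstacles

  open Scene public

  LeftOfWall : ℕ → Carrier → Set
  LeftOfWall n x = x < fromℕ n

  -- p is the centre of the post.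
  record IsPost {n} (S : Scene n) (τ : Carrier) (p : Point) : Set where
    field
      obstacle : Obstacle
      inScene  : obstacle ∈ obstacles S
      X≈left   : X p ≈ left obstacle
      bottom≤  : bottom obstacle ≤ Y p - τ
      ≤top     : Y p + τ ≤ top obstacle

  -- The rightward ray from p runs into o.  A ray along the line of a
  -- horizontal edge of o grazes o without hitting it.
  record Hits (p : Point) (o : Obstacle) : Set where
    field
      X≤left   : X p ≤ left o
      bottom<Y : bottom o < Y p
      Y<top    : Y p < top o

  record FirstHit {n} (S : Scene n) (p : Point) (o : Obstacle) : Set where
    field
      inScene : o ∈ obstacles S
      hit     : Hits p o
      first   : ∀ {o′} → o′ ∈ obstacles S → Hits p o′ → left o ≤ left o′

  cornerY : Direction → Obstacle → Carrier
  cornerY up   = top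
  cornerY down = bottom

  -- Distance from the point at height y of the left edge of o to an end of
  -- that edge.
  cornerDistance : Direction → Obstacle → Carrier → Carrier
  cornerDistance d o y = ∣ cornerY d o - y ∣

  IsNearestCorner : Direction → Obstacle → Carrier → Set
  IsNearestCorner d o y = ∀ d′ → cornerDistance d o y ≤ cornerDistance d′ o y

  -- The τ-paths that end at a post, by start point and end point.  A τ-path
  -- that reaches the wall, possibly while going around an obstacle, has no
  -- derivation.  When both corners are equally near, either may be used.
  data TauPath {n} (S : Scene n) (τ : Carrier) : Point → Point → Set where
    stop   : ∀ {x y o} →
             FirstHit S ⟨ x , y ⟩ o →
             LeftOfWall n (left o) →
             (∀ d → τ ≤ cornerDistance d o y) →
             TauPath S τ ⟨ x , y ⟩ ⟨ left o , y ⟩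
    around : ∀ {x y o q} →
             FirstHit S ⟨ x , y ⟩ o →
             LeftOfWall n (right o) →
             (d : Direction) →
             IsNearestCorner d o y →
             cornerDistance d o y < τ →
             TauPath S τ ⟨ right o , y ⟩ q →
             TauPath S τ ⟨ x , y ⟩ q

  tauTrace : ∀ {n} {S : Scene n} {τ p q} → TauPath S τ p q → Path
  tauTrace (stop {x} {y} {o} _ _ _) =
    horizontal x (left o) y ∷ []
  tauTrace (around {x} {y} {o} _ _ d _ _ t) =
    horizontal x (left o) y ∷
    vertical (left o) y (cornerY d o) ∷
    horizontal (left o) (right o) (cornerY d o) ∷
    vertical (right o) (cornerY d o) y ∷
    tauTrace t

  postEnd : Direction → Carrier → Point → Point
  postEnd up   τ p = ⟨ X p , Y p + τ ⟩
  postEnd down τ p = ⟨ X p , Y p - τ ⟩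

  -- Q is the up-child (d = up) or down-child (d = down) of P.
  record Child {n} (S : Scene n) (τ : Carrier) (d : Direction) (P Q : Point) : Set where
    constructor child
    field
      tauPath : TauPath S τ (postEnd d τ P) Q

  childEdge : ∀ {n} {S : Scene n} {τ d P Q} → Child S τ d P Q → Path
  childEdge {τ = τ} {d} {P} (child t) =
    vertical (X P) (Y P) (Y (postEnd d τ P)) ∷ tauTrace t

  -- With P i m standing for Pᵢᵐ (indices from 1), how the node at (i , m)
  -- arises from its parent.
  data NodeAt {n} (S : Scene n) (τ : Carrier) (P : ℕ → ℕ → Point) : ℕ → ℕ → Set where
    root      : NodeAt S τ P 1 1
    firstRow  : ∀ {m} →
                Child S τ up (P 1 (suc m)) (P 1 (suc (suc m))) →
                NodeAt S τ P 1 (suc (suc m))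
    firstCol  : ∀ {i} →
                Child S τ down (P (suc i) 1) (P (suc (suc i)) 1) →
                NodeAt S τ P (suc (suc i)) 1
    innerDown : ∀ {i m} →
                X (P (suc (suc i)) (suc m)) < X (P (suc i) (suc (suc m))) →
                Child S τ down (P (suc i) (suc (suc m))) (P (suc (suc i)) (suc (suc m))) →
                NodeAt S τ P (suc (suc i)) (suc (suc m))
    innerUp   : ∀ {i m} →
                ¬ (X (P (suc (suc i)) (suc m)) < X (P (suc i) (suc (suc m)))) →
                Child S τ up (P (suc (suc i)) (suc m)) (P (suc (suc i)) (suc (suc m))) →
                NodeAt S τ P (suc (suc i)) (suc (suc m))

  -- The edge from the parent; empty for the root.
  edgeInto : ∀ {n} {S : Scene n} {τ P i m} → NodeAt S τ P i m → Path
  edgeInto root            = []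
  edgeInto (firstRow t)    = childEdge t
  edgeInto (firstCol t)    = childEdge t
  edgeInto (innerDown _ t) = childEdge t
  edgeInto (innerUp _ t)   = childEdge t

  _∈[1,_] : ℕ → ℕ → Set
  i ∈[1, k ] = 1 ℕ.≤ i × i ℕ.≤ k

  pred∈ : ∀ {i k} → suc (suc i) ∈[1, k ] → suc i ∈[1, k ]
  pred∈ (_ , 2+i≤k) = s≤s z≤n , ℕ.<⇒≤ 2+i≤k

  -- The k × M fence-tree with root P₀.  Values of node outside
  -- 1 ≤ i ≤ k, 1 ≤ m ≤ M are irrelevant.
  record FenceTree {n} (S : Scene n) (τ : Carrier) (k M : ℕ) (P₀ : Point) : Set where
    field
      1≤k    : 1 ℕ.≤ k
      1≤M    : 1 ℕ.≤ M
      node   : ℕ → ℕ → Point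
      root≡  : node 1 1 ≡ P₀
      nodeAt : ∀ {i m} → i ∈[1, k ] → m ∈[1, M ] → NodeAt S τ node i m

    pathFromRootTo : ∀ i m → i ∈[1, k ] → m ∈[1, M ] → Path
    pathFromRootTo i m i∈ m∈ with nodeAt i∈ m∈
    ... | root                       = []
    ... | e@(firstRow {m} _)         = pathFromRootTo 1 (suc m) i∈ (pred∈ m∈) ++ edgeInto e
    ... | e@(firstCol {i} _)         = pathFromRootTo (suc i) 1 (pred∈ i∈) m∈ ++ edgeInto e
    ... | e@(innerDown {i} {m} _ _)  = pathFromRootTo (suc i) (suc (suc m)) (pred∈ i∈) m∈ ++ edgeInto e
    ... | e@(innerUp {i} {m} _ _)    = pathFromRootTo (suc (suc i)) (suc m) i∈ (pred∈ m∈) ++ edgeInto e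

    rootToLast : Path
    rootToLast = pathFromRootTo k M (1≤k , ℕ.≤-refl) (1≤M , ℕ.≤-refl)

    Δx : Carrier
    Δx = X (node k M) - X (node 1 1)

    totalEdgeLength : Carrier
    totalEdgeLength =
      sum λ (i : Fin k) → sum λ (m : Fin M) →
        pathLength (edgeInto (nodeAt (s≤s z≤n , toℕ<n i) (s≤s z≤n , toℕ<n m)))

{-# OPTIONS --safe #-}

-- Going around an obstacle costs at most 2τ of vertical travel and advances
-- at least 1 to the right, and τ ≥ 1, so an edge from P to Q has length at
-- most τ + 3τ (X Q - X P).  Along the path to the last node the second terms
-- telescope.  For the whole tree they telescope row by row, because the parent
-- of Pᵢᵐ is the one of its two candidates that lies further to the right, so
-- that the edge into Pᵢᵐ advances by at most Xᵢᵐ - Xᵢᵐ⁻¹.  The first terms are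
-- counted using τ M = 2L + k τ and k τ ≤ L.
module Submission where

open import Algebra.Bundles using (CommutativeMonoid)
import Algebra.Construct.NaturalChoice.Max as Max
import Algebra.Properties.CommutativeSemigroup as CommutativeSemigroupProperties
import Algebra.Properties.Ring as RingProperties
import Algebra.Solver.Ring.NaturalCoefficients.Default as SemiringSolver
open import Data.Fin.Base as Fin using (Fin; toℕ)
open import Data.Fin.Properties using (toℕ<n)
open import Data.List.Base using ([]; _∷_; _++_)
open import Data.Nat.Base as ℕ using (ℕ; zero; suc; z≤n; s≤s)
import Data.Nat.Properties as ℕ
open import Data.Product.Base using (_×_; _,_; proj₁; proj₂)
open import Data.Sum.Base using (inj₁; inj₂)
open import Defs
open import Relation.Binary.Bundles using (TotalOrder)
import Relation.Binary.Construct.NonStrictToStrict as NonStrictToStrict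
import Relation.Binary.Reasoning.PartialOrder as PartialOrderReasoning
open import Relation.Binary.Structures using (IsDecTotalOrder)
open import Relation.Nullary.Decidable.Core using (yes; no)
open import Relation.Nullary.Negation.Core using (¬_; contradiction)

-- Ordered-field inequalities, finite sums and absolute values.

module OrderedField (ℝ : Reals) where
  open Reals ℝ
  open RingProperties ring
  open SemiringSolver commutativeSemiring using (solve; _:+_; _:*_; _:=_; con)
  open Max totalOrder using (⊔-cong; ⊔-comm; x≤y⇒y⊔x≈y)
  open IsDecTotalOrder isDecTotalOrder public
    using (total; antisym; _≟_)
    renaming (reflexive to ≤-reflexive; refl to ≤-refl; trans to ≤-trans)
  open PartialOrderReasoning (TotalOrder.poset totalOrder)

  ≮⇒≥ : ∀ {x y} → ¬ x < y → y ≤ x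
  ≮⇒≥ = NonStrictToStrict.≮⇒≥ _≈_ _≤_ sym _≟_ ≤-reflexive total

  +-monoʳ-≤ : ∀ z {x y} → x ≤ y → z + x ≤ z + y
  +-monoʳ-≤ z {x} {y} x≤y = begin
    z + x ≈⟨ +-comm z x ⟩
    x + z ≤⟨ +-monoˡ-≤ z x≤y ⟩
    y + z ≈⟨ +-comm y z ⟩
    z + y ∎

  +-mono-≤ : ∀ {w x y z} → w ≤ x → y ≤ z → w + y ≤ x + z
  +-mono-≤ {x = x} {y} w≤x y≤z = ≤-trans (+-monoˡ-≤ y w≤x) (+-monoʳ-≤ x y≤z)

  x-y+y≈x : ∀ x y → x - y + y ≈ x
  x-y+y≈x x y = //-rightDividesˡ y x

  x≤y⇒0≤y-x : ∀ {x y} → x ≤ y → 0# ≤ y - x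
  x≤y⇒0≤y-x {x} {y} x≤y = begin
    0#    ≈⟨ -‿inverseʳ x ⟨
    x - x ≤⟨ +-monoˡ-≤ (- x) x≤y ⟩
    y - x ∎

  0≤y-x⇒x≤y : ∀ {x y} → 0# ≤ y - x → x ≤ y
  0≤y-x⇒x≤y {x} {y} 0≤y-x = begin
    x         ≈⟨ +-identityˡ x ⟨
    0# + x    ≤⟨ +-monoˡ-≤ x 0≤y-x ⟩
    y - x + x ≈⟨ x-y+y≈x y x ⟩
    y         ∎

  -‿nonNeg : ∀ {x} → x ≤ 0# → 0# ≤ - x
  -‿nonNeg {x} x≤0 = begin
    0#      ≤⟨ x≤y⇒0≤y-x x≤0 ⟩
    0# - x  ≈⟨ +-identityˡ (- x) ⟩
    - x     ∎

  *-monoʳ-≤ : ∀ {z x y} → 0# ≤ z → x ≤ y → z * x ≤ z * y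
  *-monoʳ-≤ {z} {x} {y} 0≤z x≤y = 0≤y-x⇒x≤y (begin
    0#            ≤⟨ *-nonNeg 0≤z (x≤y⇒0≤y-x x≤y) ⟩
    z * (y - x)   ≈⟨ x[y-z]≈xy-xz z y x ⟩
    z * y - z * x ∎)

  *-monoˡ-≤ : ∀ {z x y} → 0# ≤ z → x ≤ y → x * z ≤ y * z
  *-monoˡ-≤ {z} {x} {y} 0≤z x≤y = begin
    x * z ≈⟨ *-comm x z ⟩
    z * x ≤⟨ *-monoʳ-≤ 0≤z x≤y ⟩
    z * y ≈⟨ *-comm z y ⟩
    y * z ∎

  -- If instead `1# ≤ 0#`, then `- 1#` is nonnegative, and so is its square, which is `1#`.
  0≤1 : 0# ≤ 1#
  0≤1 with total 0# 1#
  ... | inj₁ 0≤1 = 0≤1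
  ... | inj₂ 1≤0 = begin
    0#            ≤⟨ *-nonNeg (-‿nonNeg 1≤0) (-‿nonNeg 1≤0) ⟩
    - 1# * - 1#   ≈⟨ -1*x≈-x (- 1#) ⟩
    - (- 1#)      ≈⟨ -‿involutive 1# ⟩
    1#            ∎

  ⁻¹-nonNeg : ∀ {x} → 0# ≤ x → ¬ x ≈ 0# → 0# ≤ x ⁻¹
  ⁻¹-nonNeg {x} 0≤x x≉0 with total 0# (x ⁻¹)
  ... | inj₁ 0≤x⁻¹ = 0≤x⁻¹
  ... | inj₂ x⁻¹≤0 = contradiction (antisym 0≤1 1≤0) 0≉1
    where
    1≤0 : 1# ≤ 0#
    1≤0 = begin
      1#       ≈⟨ *-inverseʳ x≉0 ⟨
      x * x ⁻¹ ≤⟨ *-monoʳ-≤ 0≤x x⁻¹≤0 ⟩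
      x * 0#   ≈⟨ zeroʳ x ⟩
      0#       ∎

  x/y*y≈x : ∀ x {y} → ¬ y ≈ 0# → x / y * y ≈ x
  x/y*y≈x x {y} y≉0 = begin-equality
    x * y ⁻¹ * y   ≈⟨ solve 3 (λ x y z → x :* z :* y := x :* (y :* z)) refl x y (y ⁻¹) ⟩
    x * (y * y ⁻¹) ≈⟨ *-congˡ (*-inverseʳ y≉0) ⟩
    x * 1#         ≈⟨ *-identityʳ x ⟩
    x              ∎

  *-cancelʳ-≤ : ∀ {x y z} → 0# ≤ z → ¬ z ≈ 0# → x * z ≤ y * z → x ≤ y
  *-cancelʳ-≤ {x} {y} {z} 0≤z z≉0 xz≤yz = begin
    x              ≈⟨ undo x ⟨
    x * z * z ⁻¹   ≤⟨ *-monoˡ-≤ (⁻¹-nonNeg 0≤z z≉0) xz≤yz ⟩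
    y * z * z ⁻¹   ≈⟨ undo y ⟩
    y              ∎
    where
    undo : ∀ w → w * z * z ⁻¹ ≈ w
    undo w = trans (*-assoc w z (z ⁻¹)) (trans (*-congˡ (*-inverseʳ z≉0)) (*-identityʳ w))

  -- In the case `y ≤ x` one has `x * x ≤ y * y ≤ y * x`, and `x` can be cancelled unless it is
  -- zero.
  x²≤y²⇒x≤y : ∀ {x y} → 0# ≤ x → 0# ≤ y → x * x ≤ y * y → x ≤ y
  x²≤y²⇒x≤y {x} {y} 0≤x 0≤y x²≤y² with total x y | x ≟ 0#
  ... | inj₁ x≤y | _       = x≤y
  ... | inj₂ _   | yes x≈0 = ≤-trans (≤-reflexive x≈0) 0≤y
  ... | inj₂ y≤x | no x≉0  =
    *-cancelʳ-≤ 0≤x x≉0 (≤-trans x²≤y² (*-monoʳ-≤ 0≤y y≤x))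

  x≤x*y : ∀ {x y} → 0# ≤ x → 1# ≤ y → x ≤ x * y
  x≤x*y {x} {y} 0≤x 1≤y = begin
    x      ≈⟨ *-identityʳ x ⟨
    x * 1# ≤⟨ *-monoʳ-≤ 0≤x 1≤y ⟩
    x * y  ∎

  x≤y*x : ∀ {x y} → 0# ≤ x → 1# ≤ y → x ≤ y * x
  x≤y*x {x} {y} 0≤x 1≤y = ≤-trans (x≤x*y 0≤x 1≤y) (≤-reflexive (*-comm x y))

  fromℕ-nonNeg : ∀ n → 0# ≤ fromℕ n
  fromℕ-nonNeg zero    = ≤-refl
  fromℕ-nonNeg (suc n) = begin
    0#           ≈⟨ +-identityˡ 0# ⟨
    0# + 0#      ≤⟨ +-mono-≤ 0≤1 (fromℕ-nonNeg n) ⟩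
    1# + fromℕ n ∎

  fromℕ-mono-≤ : ∀ {m n} → m ℕ.≤ n → fromℕ m ≤ fromℕ n
  fromℕ-mono-≤ {n = n} z≤n = fromℕ-nonNeg n
  fromℕ-mono-≤ (s≤s m≤n)   = +-monoʳ-≤ 1# (fromℕ-mono-≤ m≤n)

  1≤fromℕ : ∀ {n} → 1 ℕ.≤ n → 1# ≤ fromℕ n
  1≤fromℕ {n} 1≤n = begin
    1#      ≈⟨ +-identityʳ 1# ⟨
    fromℕ 1 ≤⟨ fromℕ-mono-≤ 1≤n ⟩
    fromℕ n ∎

  1≤x⇒x≉0 : ∀ {x} → 1# ≤ x → ¬ x ≈ 0#
  1≤x⇒x≉0 1≤x x≈0 = 0≉1 (antisym 0≤1 (≤-trans 1≤x (≤-reflexive x≈0)))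

  ∣-∣-cong : ∀ {x y} → x ≈ y → ∣ x ∣ ≈ ∣ y ∣
  ∣-∣-cong x≈y = ⊔-cong x≈y (-‿cong x≈y)

  0≤x⇒∣x∣≈x : ∀ {x} → 0# ≤ x → ∣ x ∣ ≈ x
  0≤x⇒∣x∣≈x {x} 0≤x = x≤y⇒y⊔x≈y (begin
    - x     ≈⟨ +-identityˡ (- x) ⟨
    0# - x  ≤⟨ +-monoˡ-≤ (- x) 0≤x ⟩
    x - x   ≈⟨ -‿inverseʳ x ⟩
    0#      ≤⟨ 0≤x ⟩
    x       ∎)

  ∣-x∣≈∣x∣ : ∀ x → ∣ - x ∣ ≈ ∣ x ∣
  ∣-x∣≈∣x∣ x = trans (⊔-cong refl (-‿involutive x)) (⊔-comm (- x) x)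

  ∣x-y∣≈∣y-x∣ : ∀ x y → ∣ x - y ∣ ≈ ∣ y - x ∣
  ∣x-y∣≈∣y-x∣ x y = begin-equality
    ∣ x - y ∣     ≈⟨ ∣-x∣≈∣x∣ (x - y) ⟨
    ∣ - (x - y) ∣ ≈⟨ ∣-∣-cong (⁻¹-anti-homo-// x y) ⟩
    ∣ y - x ∣     ∎

  -- Each term is at most `c` plus `d` times the increment of the potential `u`, so the increments
  -- collapse to the two ends. The induction peels off the first term and shifts `u` by one.
  sum-telescope : ∀ {n} (f : Fin n → Carrier) (u : ℕ → Carrier) {c d} →
                  (∀ j → f j + d * u (toℕ j) ≤ c + d * u (suc (toℕ j))) →
                  sum f + d * u 0 ≤ fromℕ n * c + d * u n
  sum-telescope {zero} f u {c} {d} _ =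
    ≤-reflexive (+-congʳ (sym (zeroˡ c)))
  sum-telescope {suc n} f u {c} {d} step = begin
    f Fin.zero + s + d * u 0
      ≈⟨ solve 3 (λ f s e → f :+ s :+ e := f :+ e :+ s) refl (f Fin.zero) s (d * u 0) ⟩
    f Fin.zero + d * u 0 + s
      ≤⟨ +-monoˡ-≤ s (step Fin.zero) ⟩
    c + d * u 1 + s
      ≈⟨ solve 3 (λ c e s → c :+ e :+ s := c :+ (s :+ e)) refl c (d * u 1) s ⟩
    c + (s + d * u 1)
      ≤⟨ +-monoʳ-≤ c (sum-telescope (λ j → f (Fin.suc j)) (λ m → u (suc m)) (λ j → step (Fin.suc j))) ⟩
    c + (fromℕ n * c + d * u (suc n))
      ≈⟨ solve 3 (λ c n e → c :+ (n :* c :+ e) := (con 1 :+ n) :* c :+ e) refl c (fromℕ n) (d * u (suc n)) ⟩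
    fromℕ (suc n) * c + d * u (suc n) ∎
    where s = sum (λ j → f (Fin.suc j))

  sum-≤ : ∀ {n} (f : Fin n → Carrier) {c} → (∀ j → f j ≤ c) → sum f ≤ fromℕ n * c
  sum-≤ {zero}  f {c} f≤c = ≤-reflexive (sym (zeroˡ c))
  sum-≤ {suc n} f {c} f≤c = begin
    f Fin.zero + sum (λ j → f (Fin.suc j))
      ≤⟨ +-mono-≤ (f≤c Fin.zero) (sum-≤ (λ j → f (Fin.suc j)) (λ j → f≤c (Fin.suc j))) ⟩
    c + fromℕ n * c
      ≈⟨ solve 2 (λ c n → c :+ n :* c := (con 1 :+ n) :* c) refl c (fromℕ n) ⟩
    fromℕ (suc n) * c ∎

  -- Indices are confined to the range from `1` to `k`, because this is applied to tree nodes, which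
  -- are constrained only there. The induction is on the upper index, through `≤′`.
  steps⇒mono : ∀ (u : ℕ → Carrier) {k} →
               (∀ {i} → suc (suc i) ℕ.≤ k → u (suc i) ≤ u (suc (suc i))) →
               ∀ {i j} → 1 ℕ.≤ i → i ℕ.≤ j → j ℕ.≤ k → u i ≤ u j
  steps⇒mono u {k} step {suc i} 1≤i i≤j j≤k = go (ℕ.≤⇒≤′ i≤j) j≤k
    where
    go : ∀ {j} → suc i ℕ.≤′ j → j ℕ.≤ k → u (suc i) ≤ u j
    go ℕ.≤′-refl                _   = ≤-refl
    go (ℕ.≤′-step {zero}  i≤′j) j≤k = contradiction (ℕ.≤′⇒≤ i≤′j) λ ()
    go (ℕ.≤′-step {suc j} i≤′j) j≤k = ≤-trans (go i≤′j (ℕ.<⇒≤ j≤k)) (step j≤k)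

  -- The bounds on lengths are stated in the form of the hypothesis, where all
  -- terms are subtraction-free and rearranging them is a semiring identity.
  move-to-difference : ∀ {a b d x y} → a + d * x ≤ b + d * y → a ≤ b + d * (y - x)
  move-to-difference {a} {b} {d} {x} {y} h = begin
    a                     ≈⟨ //-rightDividesʳ (d * x) a ⟨
    a + d * x - d * x     ≤⟨ +-monoˡ-≤ (- (d * x)) h ⟩
    b + d * y - d * x     ≈⟨ +-assoc b (d * y) (- (d * x)) ⟩
    b + (d * y - d * x)   ≈⟨ +-congˡ (x[y-z]≈xy-xz d y x) ⟨
    b + d * (y - x)       ∎

-- Length of a single tree edge in terms of its horizontal advance.

module EdgeLength (ℝ : Reals) where
  open Reals ℝ
  open Navigation ℝ
  open OrderedField ℝ
  open RingProperties ring
  open SemiringSolver commutativeSemiring using (solve; _:+_; _:*_; _:=_; con)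
  open PartialOrderReasoning (TotalOrder.poset totalOrder)

  left≤right : ∀ o → left o ≤ right o
  left≤right o = 0≤y-x⇒x≤y (≤-trans 0≤1 (width≥1 o))

  TauPath-X≤ : ∀ {n} {S : Scene n} {τ p q} → TauPath S τ p q → X p ≤ X q
  TauPath-X≤ (stop h _ _)                 = Hits.X≤left (FirstHit.hit h)
  TauPath-X≤ (around {o = o} h _ _ _ _ t) =
    ≤-trans (Hits.X≤left (FirstHit.hit h)) (≤-trans (left≤right o) (TauPath-X≤ t))

  Child-X≤ : ∀ {n} {S : Scene n} {τ d P Q} → Child S τ d P Q → X P ≤ X Q
  Child-X≤ {d = up}   (child t) = TauPath-X≤ t
  Child-X≤ {d = down} (child t) = TauPath-X≤ t

  pathLength-++ : ∀ π π′ → pathLength (π ++ π′) ≈ pathLength π + pathLength π′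
  pathLength-++ []      π′ = sym (+-identityˡ _)
  pathLength-++ (s ∷ π) π′ = trans (+-congˡ (pathLength-++ π π′)) (sym (+-assoc _ _ _))

  horizontal-≤ : ∀ {d x y} → 1# ≤ d → x ≤ y → ∣ y - x ∣ + d * x ≤ d * y
  horizontal-≤ {d} {x} {y} 1≤d x≤y = begin
    ∣ y - x ∣ + d * x     ≈⟨ +-congʳ (0≤x⇒∣x∣≈x 0≤y-x) ⟩
    y - x + d * x         ≤⟨ +-monoˡ-≤ (d * x) (x≤y*x 0≤y-x 1≤d) ⟩
    d * (y - x) + d * x   ≈⟨ distribˡ d (y - x) x ⟨
    d * (y - x + x)       ≈⟨ *-congˡ (x-y+y≈x y x) ⟩
    d * y                 ∎
    where
    0≤y-x : 0# ≤ y - x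
    0≤y-x = x≤y⇒0≤y-x x≤y

  -- With `w = y - x`, each of the three pieces is at most `τ * w`: the vertical ones since `w` is
  -- at least 1, the horizontal one since `τ` is. This is the origin of the factor 3.
  detour-≤ : ∀ {τ x y v v′} → 1# ≤ τ → 1# ≤ y - x → v ≤ τ → v′ ≤ τ →
             v + (∣ y - x ∣ + v′) + fromℕ 3 * τ * x ≤ fromℕ 3 * τ * y
  detour-≤ {τ} {x} {y} {v} {v′} 1≤τ 1≤w v≤τ v′≤τ = begin
    v + (∣ w ∣ + v′) + fromℕ 3 * τ * x
      ≈⟨ +-congʳ (+-congˡ (+-congʳ (0≤x⇒∣x∣≈x 0≤w))) ⟩
    v + (w + v′) + fromℕ 3 * τ * x
      ≤⟨ +-monoˡ-≤ _ (+-mono-≤ (≤-trans v≤τ τ≤τw) (+-mono-≤ (x≤y*x 0≤w 1≤τ) (≤-trans v′≤τ τ≤τw))) ⟩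
    τ * w + (τ * w + τ * w) + fromℕ 3 * τ * x
      ≈⟨ solve 3 (λ τ w x → τ :* w :+ (τ :* w :+ τ :* w) :+ three :* τ :* x
                            := three :* τ :* (w :+ x)) refl τ w x ⟩
    fromℕ 3 * τ * (w + x)
      ≈⟨ *-congˡ (x-y+y≈x y x) ⟩
    fromℕ 3 * τ * y ∎
    where
    w = y - x
    0≤w : 0# ≤ w
    0≤w = ≤-trans 0≤1 1≤w
    τ≤τw : τ ≤ τ * w
    τ≤τw = x≤x*y (≤-trans 0≤1 1≤τ) 1≤w
    three = con 1 :+ (con 1 :+ (con 1 :+ con 0))

  module _ {n} {S : Scene n} {τ : Carrier} (1≤τ : 1# ≤ τ) where

    1≤3τ : 1# ≤ fromℕ 3 * τ
    1≤3τ = ≤-trans 1≤τ (x≤y*x (≤-trans 0≤1 1≤τ) (1≤fromℕ {3} (s≤s z≤n)))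

    -- Free runs and detours both cost at most `3τ` per unit of advance, so the whole trace is paid
    -- for by its advance, by induction on the obstacles met.
    tauTrace-≤ : ∀ {p q} (t : TauPath S τ p q) →
                 pathLength (tauTrace t) + fromℕ 3 * τ * X p ≤ fromℕ 3 * τ * X q
    tauTrace-≤ (stop {x} {y} {o} h _ _) = begin
      ∣ left o - x ∣ + 0# + fromℕ 3 * τ * x ≈⟨ +-congʳ (+-identityʳ _) ⟩
      ∣ left o - x ∣ + fromℕ 3 * τ * x      ≤⟨ horizontal-≤ 1≤3τ (Hits.X≤left (FirstHit.hit h)) ⟩
      fromℕ 3 * τ * left o                  ∎
    tauTrace-≤ (around {x} {y} {o} {q} h _ dir _ v<τ t) = begin
      a + (v + (w + (v′ + r))) + d * x
        ≈⟨ solve 6 (λ a v w v′ r e → a :+ (v :+ (w :+ (v′ :+ r))) :+ e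
                                     := v :+ (w :+ v′) :+ (a :+ e) :+ r) refl a v w v′ r (d * x) ⟩
      v + (w + v′) + (a + d * x) + r
        ≤⟨ +-monoˡ-≤ r (+-monoʳ-≤ _ (horizontal-≤ 1≤3τ (Hits.X≤left (FirstHit.hit h)))) ⟩
      v + (w + v′) + d * left o + r
        ≤⟨ +-monoˡ-≤ r (detour-≤ 1≤τ (width≥1 o) v≤τ v′≤τ) ⟩
      d * right o + r
        ≈⟨ +-comm _ r ⟩
      r + d * right o
        ≤⟨ tauTrace-≤ t ⟩
      d * X q ∎
      where
      d  = fromℕ 3 * τ
      a  = ∣ left o - x ∣
      v  = ∣ cornerY dir o - y ∣
      w  = ∣ right o - left o ∣
      v′ = ∣ y - cornerY dir o ∣
      r  = pathLength (tauTrace t)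
      v≤τ : v ≤ τ
      v≤τ = proj₁ v<τ
      v′≤τ : v′ ≤ τ
      v′≤τ = ≤-trans (≤-reflexive (∣x-y∣≈∣y-x∣ y (cornerY dir o))) v≤τ

    postEnd-distance : ∀ d P → ∣ Y (postEnd d τ P) - Y P ∣ ≈ τ
    postEnd-distance up   P = trans (∣-∣-cong (xyx⁻¹≈y (Y P) τ)) (0≤x⇒∣x∣≈x (≤-trans 0≤1 1≤τ))
    postEnd-distance down P =
      trans (∣-∣-cong (xyx⁻¹≈y (Y P) (- τ)))
        (trans (∣-x∣≈∣x∣ τ) (0≤x⇒∣x∣≈x (≤-trans 0≤1 1≤τ)))

    -- The additive `τ` pays for the vertical segment from the centre of the post to its end; that
    -- segment does not advance.
    childEdge-≤ : ∀ {d P Q} (c : Child S τ d P Q) →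
                  pathLength (childEdge c) + fromℕ 3 * τ * X P ≤ τ + fromℕ 3 * τ * X Q
    childEdge-≤ {d} {P} {Q} (child t) = begin
      ∣ Y (postEnd d τ P) - Y P ∣ + r + fromℕ 3 * τ * X P
        ≈⟨ trans (+-congʳ (+-congʳ (postEnd-distance d P))) (+-assoc τ r _) ⟩
      τ + (r + fromℕ 3 * τ * X P)
        ≤⟨ +-monoʳ-≤ τ (trace-≤ d t) ⟩
      τ + fromℕ 3 * τ * X Q ∎
      where
      r = pathLength (tauTrace t)
      -- Splitting on the direction makes `X (postEnd d τ P)` reduce to `X P`.
      trace-≤ : ∀ d (t : TauPath S τ (postEnd d τ P) Q) →
                pathLength (tauTrace t) + fromℕ 3 * τ * X P ≤ fromℕ 3 * τ * X Q
      trace-≤ up   t = tauTrace-≤ t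
      trace-≤ down t = tauTrace-≤ t

-- Summation of edge lengths along the root path and over the whole tree.

module TreeLength (ℝ : Reals) {n k M : ℕ} where
  open Reals ℝ
  open CommutativeSemigroupProperties (CommutativeMonoid.commutativeSemigroup +-commutativeMonoid)
    using (x∙yz≈y∙xz)
  open Navigation ℝ
  open OrderedField ℝ
  open EdgeLength ℝ
  open SemiringSolver commutativeSemiring using (solve; _:+_; _:*_; _:=_; con)
  open PartialOrderReasoning (TotalOrder.poset totalOrder)

  module _ {S : Scene n} {τ : Carrier} {P₀ : Point} (1≤τ : 1# ≤ τ)
           (T : FenceTree S τ k M P₀) where
    open FenceTree T

    private
      d x₀ : Carrier
      d  = fromℕ 3 * τ
      x₀ = X (node 1 1)

      0≤τ : 0# ≤ τ
      0≤τ = ≤-trans 0≤1 1≤τ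

      0≤d : 0# ≤ d
      0≤d = ≤-trans 0≤1 (1≤3τ {S = S} 1≤τ)

    -- When the parent is the other candidate, in the same row, the choice rule puts it at least as
    -- far right as the node of the previous row, and the edge only moves further right.
    NodeAt-above : ∀ {i m} → NodeAt S τ node (suc (suc i)) (suc m) →
                   X (node (suc i) (suc m)) ≤ X (node (suc (suc i)) (suc m))
    NodeAt-above (firstCol c)    = Child-X≤ c
    NodeAt-above (innerDown _ c) = Child-X≤ c
    NodeAt-above (innerUp ≮ c)   = ≤-trans (≮⇒≥ ≮) (Child-X≤ c)

    X-mono-col : ∀ {m} → suc m ℕ.≤ M → ∀ {i j} → 1 ℕ.≤ i → i ℕ.≤ j → j ℕ.≤ k →
                 X (node i (suc m)) ≤ X (node j (suc m))
    X-mono-col {m} m<M = steps⇒mono (λ i → X (node i (suc m)))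
      (λ i<k → NodeAt-above (nodeAt (s≤s z≤n , i<k) (s≤s z≤n , m<M)))

    -- One more edge costs one more `τ`, and its `d`-term telescopes with that of the path. The
    -- coefficient `b` is fixed only up to `≈`, since either the row or the column index may be the
    -- one that grows.
    extend-path-≤ : ∀ {dir P Q a b} (c : Child S τ dir P Q) π →
                    pathLength π + d * x₀ ≤ a * τ + d * X P →
                    b ≈ 1# + a →
                    pathLength (π ++ childEdge c) + d * x₀ ≤ b * τ + d * X Q
    extend-path-≤ {P = P} {Q} {a} {b} c π π≤ b≈1+a = begin
      pathLength (π ++ childEdge c) + d * x₀
        ≈⟨ +-congʳ (pathLength-++ π (childEdge c)) ⟩
      p + e + d * x₀
        ≈⟨ solve 3 (λ p e z → p :+ e :+ z := p :+ z :+ e) refl p e (d * x₀) ⟩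
      p + d * x₀ + e
        ≤⟨ +-monoˡ-≤ e π≤ ⟩
      a * τ + d * X P + e
        ≈⟨ solve 3 (λ a x e → a :+ x :+ e := a :+ (e :+ x)) refl (a * τ) (d * X P) e ⟩
      a * τ + (e + d * X P)
        ≤⟨ +-monoʳ-≤ (a * τ) (childEdge-≤ 1≤τ c) ⟩
      a * τ + (τ + d * X Q)
        ≈⟨ solve 3 (λ a τ x → a :* τ :+ (τ :+ x) := (con 1 :+ a) :* τ :+ x) refl a τ (d * X Q) ⟩
      (1# + a) * τ + d * X Q
        ≈⟨ +-congʳ (*-congʳ b≈1+a) ⟨
      b * τ + d * X Q ∎
      where
      p = pathLength π
      e = pathLength (childEdge c)

    -- Every edge raises exactly one of the two indices by one, so `m + i` bounds the number of
    -- edges, with a surplus of 2 from the root.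
    pathFromRootTo-≤ : ∀ i m (i∈ : i ∈[1, k ]) (m∈ : m ∈[1, M ]) →
                       pathLength (pathFromRootTo i m i∈ m∈) + d * x₀ ≤
                       (fromℕ m + fromℕ i) * τ + d * X (node i m)
    pathFromRootTo-≤ i m i∈ m∈ with nodeAt i∈ m∈
    ... | root = +-monoˡ-≤ _
            (*-nonNeg (≤-trans (≤-reflexive (sym (+-identityˡ 0#)))
                               (+-mono-≤ (fromℕ-nonNeg 1) (fromℕ-nonNeg 1))) 0≤τ)
    ... | firstRow {m} c =
            extend-path-≤ c (pathFromRootTo 1 (suc m) i∈ (pred∈ m∈))
              (pathFromRootTo-≤ 1 (suc m) i∈ (pred∈ m∈)) (+-assoc _ _ _)
    ... | firstCol {i} c =
            extend-path-≤ c (pathFromRootTo (suc i) 1 (pred∈ i∈) m∈)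
              (pathFromRootTo-≤ (suc i) 1 (pred∈ i∈) m∈) (x∙yz≈y∙xz _ _ _)
    ... | innerDown {i} {m} _ c =
            extend-path-≤ c (pathFromRootTo (suc i) (suc (suc m)) (pred∈ i∈) m∈)
              (pathFromRootTo-≤ (suc i) (suc (suc m)) (pred∈ i∈) m∈) (x∙yz≈y∙xz _ _ _)
    ... | innerUp {i} {m} _ c =
            extend-path-≤ c (pathFromRootTo (suc (suc i)) (suc m) i∈ (pred∈ m∈))
              (pathFromRootTo-≤ (suc (suc i)) (suc m) i∈ (pred∈ m∈)) (+-assoc _ _ _)

    -- The convention at index 0 makes every row start from the root, so that a
    -- single telescoping sum also covers the edge into the first column.
    rowX : ℕ → ℕ → Carrier
    rowX i zero    = x₀
    rowX i (suc m) = X (node i (suc m))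

    edgeInto-≤ : ∀ {i m} → suc i ℕ.≤ k → (e : NodeAt S τ node (suc i) (suc m)) →
                 pathLength (edgeInto e) + d * rowX (suc i) m ≤ τ + d * rowX (suc i) (suc m)
    edgeInto-≤ i<k root             = +-monoˡ-≤ _ 0≤τ
    edgeInto-≤ i<k (firstRow c)     = childEdge-≤ 1≤τ c
    edgeInto-≤ i<k (firstCol c)     =
      -- The row potential starts at the root, and the parent in the first column is no further left
      -- than the root.
      ≤-trans (+-monoʳ-≤ _ (*-monoʳ-≤ 0≤d (X-mono-col 1≤M (s≤s z≤n) (s≤s z≤n) (ℕ.<⇒≤ i<k))))
              (childEdge-≤ 1≤τ c)
    edgeInto-≤ i<k (innerDown lt c) =
      ≤-trans (+-monoʳ-≤ _ (*-monoʳ-≤ 0≤d (proj₁ lt))) (childEdge-≤ 1≤τ c)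
    edgeInto-≤ i<k (innerUp _ c)    = childEdge-≤ 1≤τ c

    -- Lets every row be bounded by the same advance `Δx`, measured to the end of the last row.
    rowX-≤-last : ∀ {i m} → suc i ℕ.≤ k → 1 ℕ.≤ m → m ℕ.≤ M → rowX (suc i) m ≤ X (node k m)
    rowX-≤-last {m = suc m} i<k _ m≤M = X-mono-col m≤M (s≤s z≤n) i<k ℕ.≤-refl

    rootToLast-≤ : pathLength rootToLast ≤ (fromℕ M + fromℕ k) * τ + d * Δx
    rootToLast-≤ =
      move-to-difference (pathFromRootTo-≤ k M (1≤k , ℕ.≤-refl) (1≤M , ℕ.≤-refl))

    totalEdgeLength-≤ : totalEdgeLength ≤ fromℕ k * (fromℕ M * τ + d * Δx)
    totalEdgeLength-≤ = sum-≤ _ λ i → move-to-difference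
      (≤-trans
        (sum-telescope _ (rowX (suc (toℕ i))) λ m →
          edgeInto-≤ (toℕ<n i) (nodeAt (s≤s z≤n , toℕ<n i) (s≤s z≤n , toℕ<n m)))
        (+-monoʳ-≤ _ (*-monoʳ-≤ 0≤d (rowX-≤-last (toℕ<n i) 1≤M ℕ.≤-refl))))

-- Consequences of the choice of `τ` and `M`.

module Parameters (ℝ : Reals) where
  open Reals ℝ
  open OrderedField ℝ
  open SemiringSolver commutativeSemiring using (solve; _:+_; _:*_; _:=_; con)
  open PartialOrderReasoning (TotalOrder.poset totalOrder)

  module _ {n k : ℕ} {L τ r : Carrier} (1≤k : 1 ℕ.≤ k) (k≤n : k ℕ.≤ n)
           (n≤L : fromℕ n ≤ L) (r-root : r IsSquareRootOf (fromℕ n * fromℕ k))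
           (τ≈L/r : τ ≈ L / r) where

    private
      0≤r : 0# ≤ r
      0≤r = proj₁ r-root

      r²≈nk : r * r ≈ fromℕ n * fromℕ k
      r²≈nk = proj₂ r-root

    -- As the geometric mean of `n` and `k`, `r` lies between them; this bound and the next are
    -- obtained by comparing squares.
    r≤n : r ≤ fromℕ n
    r≤n = x²≤y²⇒x≤y 0≤r (fromℕ-nonNeg n) (begin
      r * r             ≈⟨ r²≈nk ⟩
      fromℕ n * fromℕ k ≤⟨ *-monoʳ-≤ (fromℕ-nonNeg n) (fromℕ-mono-≤ k≤n) ⟩
      fromℕ n * fromℕ n ∎)

    k≤r : fromℕ k ≤ r
    k≤r = x²≤y²⇒x≤y (fromℕ-nonNeg k) 0≤r (begin
      fromℕ k * fromℕ k ≤⟨ *-monoˡ-≤ (fromℕ-nonNeg k) (fromℕ-mono-≤ k≤n) ⟩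
      fromℕ n * fromℕ k ≈⟨ r²≈nk ⟨
      r * r             ∎)

    r≉0 : ¬ r ≈ 0#
    r≉0 = 1≤x⇒x≉0 (≤-trans (1≤fromℕ 1≤k) k≤r)

    τ*r≈L : τ * r ≈ L
    τ*r≈L = trans (*-congʳ τ≈L/r) (x/y*y≈x L r≉0)

    -- After multiplication by `r` the claim becomes `r ≤ L`, which holds through `n`.
    1≤τ : 1# ≤ τ
    1≤τ = *-cancelʳ-≤ 0≤r r≉0 (begin
      1# * r  ≈⟨ *-identityˡ r ⟩
      r       ≤⟨ r≤n ⟩
      fromℕ n ≤⟨ n≤L ⟩
      L       ≈⟨ τ*r≈L ⟨
      τ * r   ∎)

    -- Replacing `k` by the larger `r` turns the product into `τ * r`, which is `L`.
    k*τ≤L : fromℕ k * τ ≤ L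
    k*τ≤L = begin
      fromℕ k * τ ≤⟨ *-monoˡ-≤ (≤-trans 0≤1 1≤τ) k≤r ⟩
      r * τ       ≈⟨ *-comm r τ ⟩
      τ * r       ≈⟨ τ*r≈L ⟩
      L           ∎

    module _ (M : ℕ) (M≈ : fromℕ M ≈ fromℕ 2 * L / τ + fromℕ k) where

      M*τ≤3L : fromℕ M * τ ≤ fromℕ 3 * L
      M*τ≤3L = begin
        fromℕ M * τ                         ≈⟨ *-congʳ M≈ ⟩
        (fromℕ 2 * L / τ + fromℕ k) * τ     ≈⟨ distribʳ τ (fromℕ 2 * L / τ) (fromℕ k) ⟩
        fromℕ 2 * L / τ * τ + fromℕ k * τ   ≈⟨ +-congʳ (x/y*y≈x (fromℕ 2 * L) (1≤x⇒x≉0 1≤τ)) ⟩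
        fromℕ 2 * L + fromℕ k * τ           ≤⟨ +-monoʳ-≤ (fromℕ 2 * L) k*τ≤L ⟩
        fromℕ 2 * L + L
          ≈⟨ solve 2 (λ t L → t :* L :+ L := (con 1 :+ t) :* L) refl (fromℕ 2) L ⟩
        fromℕ 3 * L                         ∎

      [M+k]*τ≤4L : (fromℕ M + fromℕ k) * τ ≤ fromℕ 4 * L
      [M+k]*τ≤4L = begin
        (fromℕ M + fromℕ k) * τ     ≈⟨ distribʳ τ (fromℕ M) (fromℕ k) ⟩
        fromℕ M * τ + fromℕ k * τ   ≤⟨ +-mono-≤ M*τ≤3L k*τ≤L ⟩
        fromℕ 3 * L + L
          ≈⟨ solve 2 (λ t L → t :* L :+ L := (con 1 :+ t) :* L) refl (fromℕ 3) L ⟩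
        fromℕ 4 * L                 ∎

theorem2 : (ℝ : Reals) → let open Reals ℝ in let open Navigation ℝ in let open FenceTree in
    (n k M : ℕ) (S : Scene n) (L τ √nk : Carrier) (P₀ : Point) →
    1 ℕ.≤ k → k ℕ.≤ n →
    fromℕ n ≤ L →
    √nk IsSquareRootOf (fromℕ n * fromℕ k) →
    τ ≈ L / √nk →
    fromℕ M ≈ fromℕ 2 * L / τ + fromℕ k →
    IsPost S τ P₀ →
    (T : FenceTree S τ k M P₀) →
    pathLength (rootToLast T) ≤ fromℕ 4 * L + fromℕ 3 * τ * Δx T ×
    totalEdgeLength T ≤ fromℕ k * (fromℕ 3 * L + fromℕ 3 * τ * Δx T)
theorem2 ℝ n k M S L τ √nk P₀ 1≤k k≤n n≤L root τ≈ M≈ _ T =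
  ≤-trans (rootToLast-≤ τ≥1 T)
    (+-monoˡ-≤ _ ([M+k]*τ≤4L 1≤k k≤n n≤L root τ≈ M M≈)) ,
  ≤-trans (totalEdgeLength-≤ τ≥1 T)
    (*-monoʳ-≤ (fromℕ-nonNeg k)
      (+-monoˡ-≤ _ (M*τ≤3L 1≤k k≤n n≤L root τ≈ M M≈)))
  where
  open Reals ℝ
  open OrderedField ℝ
  open TreeLength ℝ
  open Parameters ℝ
  τ≥1 : 1# ≤ τ
  τ≥1 = 1≤τ 1≤k k≤n n≤L root τ≈
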